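{- Let $t\geq 2$ be an integer and $\mathcal{H}=\mathrm{Forb}(K_{2,t})$. Then for all $p\in[0,1]$, $$\mathrm{ed}_{\mathcal{H}}(p)\leq\frac{3p+1}{5+t}.$$
   Context: All graphs are finite and simple. $K_{2,t}$ is the complete bipartite graph with parts of sizes $2$ and $t$. For a graph $H$, $\mathrm{Forb}(H)$ is the hereditary property consisting of all graphs with no induced subgraph isomorphic to $H$. For graphs $G,G'$ on the same labeled vertex set, $\mathrm{dist}(G,G')=|E(G)\,\Delta\, E(G')|$; for a hereditary property $\mathcal{H}$ (a set of graphs closed under isomorphism and vertex deletion), $\mathrm{dist}(G,\mathcal{H})=\min\{\mathrm{dist}(G,G'): G'\in\mathcal{H},\ V(G')=V(G)\}$. The edit distance function is $$\mathrm{ed}_{\mathcal{H}}(p)=\lim_{n\to\infty}\max\left\{\mathrm{dist}(G,\mathcal{H}): |V(G)|=n,\ |E(G)|=\left\lfloor p\tbinom n2\right\rfloor\right\}\Big/\tbinom n2,\qquad p\in[0,1].$$ (The limit is known to exist, and the function is known to be continuous and concave.) -}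

module Defs where

open import Data.Bool using (Bool; true; false; _xor_)
open import Data.Bool.Properties using (xor-comm; xor-same; T?)
open import Data.Fin using (Fin; splitAt; punchIn)
open import Data.Fin.Properties using (punchIn-injective) renaming (_<?_ to _<ᶠ?_)
open import Data.Integer using (+_)
open import Data.List using (List; length; filter; cartesianProduct; allFin)
open import Data.Nat using (ℕ; suc; NonZero; _⊔_) renaming (_+_ to _+ⁿ_; _≤_ to _≤ⁿ_)
open import Data.Nat.Combinatorics using (_C_)
import Data.Nat.Properties as ℕₚ
open import Data.Product using (∃; ∃-syntax; _×_; _,_; proj₁; proj₂)
open import Data.Rational using (ℚ; 0ℚ; 1ℚ; ½; _+_; _*_; _-_; -_; _≤_; _<_; ∣_∣; _/_; 1/_; positive)
  renaming (Positive to Positiveℚ; NonZero to NonZeroℚ; NonNegative to NonNegativeℚ; nonNegative to nonNegativeℚ)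
import Data.Rational.Properties as ℚₚ
open import Data.Rational.Solver using (module +-*-Solver)
open import Data.Sum using ([_,_]′)
open import Function using (_∘_; const)
open import Function.Bundles using (_↔_; module Inverse)
open import Function.Definitions using (Injective)
open import Relation.Binary.PropositionalEquality using (_≡_; refl; sym; trans; cong; cong₂; subst)
open import Relation.Nullary using (¬_; _×-dec_)

------------------------------------------------------------------------
-- Real numbers, as Cauchy sequences of rationals

record ℝ : Set where
  field
    approx : ℕ → ℚ
    cauchy : ∀ ε → 0ℚ < ε →
             ∃[ N ] (∀ m n → N ≤ⁿ m → N ≤ⁿ n → ∣ approx m - approx n ∣ ≤ ε)

open ℝ public

infix 4 _≤ℝ_ _<ℝ_

_≤ℝ_ : ℝ → ℝ → Set
x ≤ℝ y = ∀ ε → 0ℚ < ε → ∃[ N ] (∀ n → N ≤ⁿ n → approx x n ≤ approx y n + ε)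

_<ℝ_ : ℝ → ℝ → Set
x <ℝ y = ∃[ ε ] (0ℚ < ε × ∃[ N ] (∀ n → N ≤ⁿ n → approx x n + ε ≤ approx y n))

fromℚ : ℚ → ℝ
fromℚ q .approx _ = q
fromℚ q .cauchy ε 0<ε = 0 , λ _ _ _ _ →
  subst (_≤ ε) (sym (cong ∣_∣ (ℚₚ.+-inverseʳ q))) (ℚₚ.<⇒≤ 0<ε)

fromℕ : ℕ → ℝ
fromℕ n = fromℚ (+ n / 1)

infixl 6 _+ℝ_
infixl 7 _·_ _÷_

_+ℝ_ : ℝ → ℝ → ℝ
(x +ℝ y) .approx n = approx x n + approx y n
(x +ℝ y) .cauchy ε 0<ε = Nx ⊔ Ny , bound
  where
  0<½ε : 0ℚ < ½ * ε
  0<½ε = ℚₚ.positive⁻¹ (½ * ε) {{ℚₚ.pos*pos⇒pos ½ ε {{positive 0<ε}}}}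

  Nx = cauchy x (½ * ε) 0<½ε .proj₁
  Ny = cauchy y (½ * ε) 0<½ε .proj₁

  rearrange : ∀ a b c d → (a + b) - (c + d) ≡ (a - c) + (b - d)
  rearrange = solve 4 (λ a b c d → (a :+ b) :- (c :+ d) := (a :- c) :+ (b :- d)) refl
    where open +-*-Solver

  halves : ½ * ε + ½ * ε ≡ ε
  halves = trans (sym (ℚₚ.*-distribʳ-+ ε ½ ½)) (ℚₚ.*-identityˡ ε)

  bound : ∀ m n → Nx ⊔ Ny ≤ⁿ m → Nx ⊔ Ny ≤ⁿ n →
          ∣ (approx x m + approx y m) - (approx x n + approx y n) ∣ ≤ ε
  bound m n N≤m N≤n = begin
    ∣ (approx x m + approx y m) - (approx x n + approx y n) ∣
      ≡⟨ cong ∣_∣ (rearrange (approx x m) (approx y m) (approx x n) (approx y n)) ⟩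
    ∣ (approx x m - approx x n) + (approx y m - approx y n) ∣
      ≤⟨ ℚₚ.∣p+q∣≤∣p∣+∣q∣ (approx x m - approx x n) (approx y m - approx y n) ⟩
    ∣ approx x m - approx x n ∣ + ∣ approx y m - approx y n ∣
      ≤⟨ ℚₚ.+-mono-≤
           (cauchy x (½ * ε) 0<½ε .proj₂ m n
             (ℕₚ.m⊔n≤o⇒m≤o Nx Ny N≤m) (ℕₚ.m⊔n≤o⇒m≤o Nx Ny N≤n))
           (cauchy y (½ * ε) 0<½ε .proj₂ m n
             (ℕₚ.m⊔n≤o⇒n≤o Nx Ny N≤m) (ℕₚ.m⊔n≤o⇒n≤o Nx Ny N≤n)) ⟩
    ½ * ε + ½ * ε
      ≡⟨ halves ⟩
    ε ∎
    where open ℚₚ.≤-Reasoning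

_·_ : ℚ → ℝ → ℝ
(q · x) .approx n = q * approx x n
(q · x) .cauchy ε 0<ε = cauchy x δ 0<δ .proj₁ , bound
  where
  s = 1ℚ + ∣ q ∣

  instance
    s-pos : Positiveℚ s
    s-pos = positive (ℚₚ.+-mono-<-≤ (ℚₚ.positive⁻¹ 1ℚ) (ℚₚ.0≤∣p∣ q))

    s-nonZero : NonZeroℚ s
    s-nonZero = ℚₚ.pos⇒nonZero s

  δ = 1/ s * ε

  0<δ : 0ℚ < δ
  0<δ = ℚₚ.positive⁻¹ δ {{ℚₚ.pos*pos⇒pos (1/ s) {{ℚₚ.1/pos⇒pos s}} ε {{positive 0<ε}}}}

  δ-nonNeg : NonNegativeℚ δ
  δ-nonNeg = nonNegativeℚ (ℚₚ.<⇒≤ 0<δ)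

  ∣q∣-nonNeg : NonNegativeℚ ∣ q ∣
  ∣q∣-nonNeg = nonNegativeℚ (ℚₚ.0≤∣p∣ q)

  factor : ∀ a b → q * a - q * b ≡ q * (a - b)
  factor = solve 3 (λ q a b → q :* a :- q :* b := q :* (a :- b)) refl q
    where open +-*-Solver

  ∣q∣≤s : ∣ q ∣ ≤ s
  ∣q∣≤s = subst (_≤ s) (ℚₚ.+-identityˡ ∣ q ∣)
    (ℚₚ.+-monoˡ-≤ ∣ q ∣ (ℚₚ.<⇒≤ (ℚₚ.positive⁻¹ 1ℚ)))

  sδ≡ε : s * δ ≡ ε
  sδ≡ε = trans (sym (ℚₚ.*-assoc s (1/ s) ε))
    (trans (cong (_* ε) (ℚₚ.*-inverseʳ s)) (ℚₚ.*-identityˡ ε))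

  bound : ∀ m n → cauchy x δ 0<δ .proj₁ ≤ⁿ m →
          cauchy x δ 0<δ .proj₁ ≤ⁿ n →
          ∣ q * approx x m - q * approx x n ∣ ≤ ε
  bound m n N≤m N≤n = begin
    ∣ q * approx x m - q * approx x n ∣
      ≡⟨ cong ∣_∣ (factor (approx x m) (approx x n)) ⟩
    ∣ q * (approx x m - approx x n) ∣
      ≡⟨ ℚₚ.∣p*q∣≡∣p∣*∣q∣ q (approx x m - approx x n) ⟩
    ∣ q ∣ * ∣ approx x m - approx x n ∣
      ≤⟨ ℚₚ.*-monoˡ-≤-nonNeg ∣ q ∣ {{∣q∣-nonNeg}}
           (cauchy x δ 0<δ .proj₂ m n N≤m N≤n) ⟩
    ∣ q ∣ * δ
      ≤⟨ ℚₚ.*-monoʳ-≤-nonNeg δ {{δ-nonNeg}} ∣q∣≤s ⟩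
    s * δ
      ≡⟨ sδ≡ε ⟩
    ε ∎
    where open ℚₚ.≤-Reasoning

_÷_ : ℝ → (n : ℕ) → .{{NonZero n}} → ℝ
x ÷ n = (+ 1 / n) · x

-- k = ⌊ x ⌋ for nonnegative x.  On Cauchy reals the floor is not a computable
-- function, so it is given by its graph.
IsFloor : ℝ → ℕ → Set
IsFloor x k = fromℕ k ≤ℝ x × x <ℝ fromℕ (suc k)

-- ∣ x − y ∣ ≤ ε
Within : ℚ → ℝ → ℝ → Set
Within ε x y = x ≤ℝ y +ℝ fromℚ ε × y ≤ℝ x +ℝ fromℚ ε

------------------------------------------------------------------------
-- Finite simple graphs

record Graph (n : ℕ) : Set where
  field
    adj    : Fin n → Fin n → Bool
    symm   : ∀ u v → adj u v ≡ adj v u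
    irrefl : ∀ v → adj v v ≡ false

open Graph public

-- Each edge is listed once, with its endpoints in increasing order.
edges : ∀ {n} → Graph n → List (Fin n × Fin n)
edges {n} G = filter (λ (u , v) → (u <ᶠ? v) ×-dec T? (adj G u v))
                     (cartesianProduct (allFin n) (allFin n))

edgeCount : ∀ {n} → Graph n → ℕ
edgeCount G = length (edges G)

-- The graph on the common vertex set with edge set E(G) Δ E(G′).
_△_ : ∀ {n} → Graph n → Graph n → Graph n
(G △ G′) .adj u v    = adj G u v xor adj G′ u v
(G △ G′) .symm u v   = cong₂ _xor_ (symm G u v) (symm G′ u v)
(G △ G′) .irrefl v   = cong₂ _xor_ (irrefl G v) (irrefl G′ v)

dist : ∀ {n} → Graph n → Graph n → ℕ
dist G G′ = edgeCount (G △ G′)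

_≅_ : ∀ {m n} → Graph m → Graph n → Set
_≅_ {m} {n} G G′ =
  ∃ λ (f : Fin m ↔ Fin n) →
    ∀ u v → adj G′ (Inverse.to f u) (Inverse.to f v) ≡ adj G u v

delete : ∀ {n} → Fin (suc n) → Graph (suc n) → Graph n
delete w G .adj u v  = adj G (punchIn w u) (punchIn w v)
delete w G .symm u v = symm G (punchIn w u) (punchIn w v)
delete w G .irrefl v = irrefl G (punchIn w v)

-- Some induced subgraph of G is isomorphic to H.
_InducedIn_ : ∀ {m n} → Graph m → Graph n → Set
_InducedIn_ {m} {n} H G =
  ∃ λ (f : Fin m → Fin n) →
    Injective _≡_ _≡_ f × (∀ u v → adj G (f u) (f v) ≡ adj H u v)

-- The complete bipartite graph K_{a,b}: the first a vertices form one part,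
-- the last b the other.
K : (a b : ℕ) → Graph (a +ⁿ b)
K a b = record
  { adj    = λ u v → side u xor side v
  ; symm   = λ u v → xor-comm (side u) (side v)
  ; irrefl = λ v → xor-same (side v)
  }
  where
  side : Fin (a +ⁿ b) → Bool
  side = [ const true , const false ]′ ∘ splitAt a

------------------------------------------------------------------------
-- Hereditary properties and the edit distance function

record HereditaryProperty : Set₁ where
  field
    Holds           : ∀ {n} → Graph n → Set
    iso-closed      : ∀ {m n} {G : Graph m} {G′ : Graph n} → G ≅ G′ → Holds G → Holds G′
    deletion-closed : ∀ {n} {G : Graph (suc n)} (w : Fin (suc n)) → Holds G → Holds (delete w G)

open HereditaryProperty public

Forb : ∀ {h} → Graph h → HereditaryProperty
Forb H = record
  { Holds           = λ G → ¬ (H InducedIn G)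
  ; iso-closed      = λ {m} {n} {G} {G′} (f , f-adj) H⊈G (g , g-inj , g-adj) →
      let open Inverse f
          pull : ∀ u v → adj G (from u) (from v) ≡ adj G′ u v
          pull u v = trans (sym (f-adj (from u) (from v)))
            (cong₂ (adj G′) (strictlyInverseˡ u) (strictlyInverseˡ v))
          from-inj : ∀ {u v} → from u ≡ from v → u ≡ v
          from-inj {u} {v} eq = trans (sym (strictlyInverseˡ u))
            (trans (cong to eq) (strictlyInverseˡ v))
      in H⊈G (from ∘ g , (λ eq → g-inj (from-inj eq)) ,
               λ u v → trans (pull (g u) (g v)) (g-adj u v))
  ; deletion-closed = λ w H⊈G (g , g-inj , g-adj) →
      H⊈G (punchIn w ∘ g , (λ eq → g-inj (punchIn-injective w _ _ eq)) , g-adj)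
  }

IsMin IsMax : (ℕ → Set) → ℕ → Set
IsMin P m = P m × (∀ k → P k → m ≤ⁿ k)
IsMax P m = P m × (∀ k → P k → k ≤ⁿ m)

-- d = dist(G, 𝓗)
IsDistTo : ∀ {n} → HereditaryProperty → Graph n → ℕ → Set
IsDistTo {n} 𝓗 G = IsMin λ d → ∃ λ (G′ : Graph n) → Holds 𝓗 G′ × d ≡ dist G G′

-- m = max { dist(G, 𝓗) : |V(G)| = n, |E(G)| = k }
IsMaxDist : HereditaryProperty → (n k : ℕ) → ℕ → Set
IsMaxDist 𝓗 n k = IsMax λ d → ∃ λ (G : Graph n) → edgeCount G ≡ k × IsDistTo 𝓗 G d

-- e = ed_𝓗(p), i.e. e is the limit as n → ∞ of m / C(n,2), where k = ⌊ p C(n,2) ⌋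
-- and m is the corresponding maximal distance; the NonZero condition says n ≥ 2.
-- Since k and m are determined by n (and, classically, exist for p ∈ [0,1] and
-- 𝓗 containing a graph of every order), quantifying over all such k and m
-- assumes no more of e than the limit does.
IsEd : HereditaryProperty → ℝ → ℝ → Set
IsEd 𝓗 p e =
  ∀ ε → 0ℚ < ε → ∃[ N ] (∀ n → N ≤ⁿ n → .{{_ : NonZero (n C 2)}} →
    ∀ k m → IsFloor ((+ (n C 2) / 1) · p) k → IsMaxDist 𝓗 n k m →
    Within ε (fromℚ (+ m / (n C 2))) e)

{-# OPTIONS --safe #-}
module Submission where

-- Map the vertices of G to a coloured regularity graph R on k vertices, delete the edges that
-- land on white pairs and add the non-edges that land on black ones.  Averaging over all maps,
-- some map costs at most (W E + B (C(n,2) − E)) / k², where W and B count the white and black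
-- ordered pairs of R.  If every result avoids K_{2,t}, W = 4B and k² / B ≥ t + 5, the bound follows.
--
-- For t ≥ 3, R has t + 5 black vertices; its white edges form a 4-regular graph with codegrees at
-- most 2, and all other edges are grey.  In an induced K_{2,t}, the two vertices of the small part
-- lie over distinct a and b, and the t others over distinct vertices outside N(a) ∪ N(b), which
-- has at least 4 + 4 − 2 elements: t + 6 ≤ t + 5.
--
-- Neither the floor nor the maximum in the definition of ed can be computed, but their non-existence is
-- absurd, and that is enough because ≤ on Cauchy reals is stable under double negation.

open import Defs
open import Data.Bool using (Bool; true; false; not; _∧_; _∨_; _xor_; if_then_else_)
import Data.Bool.Properties as Bool
open import Data.Empty using (⊥; ⊥-elim)
open import Data.Fin using (Fin; zero; suc; toℕ; punchIn; punchOut; splitAt; join)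
open import Data.Fin.Patterns using (0F; 1F; 2F; 3F; 4F; 5F; 6F; 7F)
import Data.Fin.Properties as Fin
import Data.Integer as ℤ
import Data.Integer.Properties as ℤ
open import Data.Integer using (+_)
open import Data.List using (_++_; length; filter; map; tabulate; cartesianProduct)
import Data.List.Properties as List
open import Data.Nat as ℕ
  using (ℕ; zero; suc; _+_; _*_; _∸_; _≤_; _<_; _≤?_; _≡ᵇ_; _<ᵇ_; _⊓_; _⊔_; ∣_-_∣;
         NonZero; z≤n; s≤s)
open import Data.Nat.Combinatorics using (_C_; nC1≡n; nCk+nC[k+1]≡[n+1]C[k+1])
open import Data.Nat.Induction using (<-rec)
import Data.Nat.Properties as ℕ
open import Data.Nat.Tactic.RingSolver using (solve-∀)
open import Data.Product using (∃; ∃-syntax; _×_; _,_; proj₁; proj₂)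
open import Data.Rational as ℚ using (ℚ; 0ℚ; 1ℚ; ½; _/_; toℚᵘ)
import Data.Rational.Properties as ℚ
open import Data.Rational.Solver using (module +-*-Solver)
open import Data.Rational.Unnormalised as ℚᵘ using (mkℚᵘ; *≡*; *≤*) renaming (_/_ to _/ᵘ_)
import Data.Rational.Unnormalised.Properties as ℚᵘ
open import Data.Sum using (_⊎_; inj₁; inj₂; map₁)
open import Function using (_∘_)
open import Function.Definitions using (Injective)
open import Relation.Binary.PropositionalEquality
  using (_≡_; _≢_; refl; sym; trans; cong; cong₂; subst; subst₂; module ≡-Reasoning)
open import Relation.Nullary using (¬_; yes; no; does; _×-dec_; _⊎-dec_)
open import Relation.Nullary.Decidable using (dec-true; dec-false; from-yes)
open import Relation.Unary using (Pred; Decidable)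
open import Algebra.Properties.Semiring.Sum ℕ.+-*-semiring
  using (sum; ∑-distrib-+; ∑-comm; sum-cong-≗; sum-remove; *-distribˡ-sum)

-- Sums over unordered pairs of vertices, and edge counts

ind : Bool → ℕ
ind b = if b then 1 else 0

-- Each unordered pair counts once, smaller index first. Peeling off the vertex `zero` is also the
-- recursion that the labelling argument follows.
pairSum : ∀ {n} → (Fin n → Fin n → ℕ) → ℕ
pairSum {zero}  f = 0
pairSum {suc n} f = sum (λ v → f zero (suc v)) + pairSum (λ u v → f (suc u) (suc v))

sum-mono : ∀ {n} {f g : Fin n → ℕ} → (∀ i → f i ≤ g i) → sum f ≤ sum g
sum-mono {zero}  f≤g = z≤n
sum-mono {suc n} f≤g = ℕ.+-mono-≤ (f≤g zero) (sum-mono (f≤g ∘ suc))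

sum-const : ∀ n c → sum {n} (λ _ → c) ≡ n * c
sum-const zero    c = refl
sum-const (suc n) c = cong (c ℕ.+_) (sum-const n c)

-- The comparison is confined to `u ≢ v` because a recoloured graph has `false` on its diagonal
-- whatever the colour there.
pairSum-mono : ∀ {n} {f g : Fin n → Fin n → ℕ} → (∀ u v → u ≢ v → f u v ≤ g u v) →
               pairSum f ≤ pairSum g
pairSum-mono {zero}  f≤g = z≤n
pairSum-mono {suc n} f≤g = ℕ.+-mono-≤ (sum-mono λ v → f≤g zero (suc v) λ ())
  (pairSum-mono λ u v u≢v → f≤g (suc u) (suc v) λ { refl → u≢v refl })

pairSum-cong : ∀ {n} {f g : Fin n → Fin n → ℕ} → (∀ u v → f u v ≡ g u v) →
               pairSum f ≡ pairSum g
pairSum-cong {zero}  f≗g = refl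
pairSum-cong {suc n} f≗g =
  cong₂ _+_ (sum-cong-≗ (λ v → f≗g zero (suc v))) (pairSum-cong λ u v → f≗g (suc u) (suc v))

pairSum-distrib-+ : ∀ {n} (f g : Fin n → Fin n → ℕ) →
                    pairSum (λ u v → f u v + g u v) ≡ pairSum f + pairSum g
pairSum-distrib-+ {zero}  f g = refl
pairSum-distrib-+ {suc n} f g = begin
  sum (λ v → f₀ v + g₀ v) + pairSum (λ u v → f₁ u v + g₁ u v)
    ≡⟨ cong₂ _+_ (∑-distrib-+ f₀ g₀) (pairSum-distrib-+ f₁ g₁) ⟩
  (sum f₀ + sum g₀) + (pairSum f₁ + pairSum g₁)
    ≡⟨ swap (sum f₀) (sum g₀) (pairSum f₁) (pairSum g₁) ⟩
  (sum f₀ + pairSum f₁) + (sum g₀ + pairSum g₁) ∎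
  where
  open ≡-Reasoning
  f₀ = λ v → f zero (suc v)
  g₀ = λ v → g zero (suc v)
  f₁ = λ u v → f (suc u) (suc v)
  g₁ = λ u v → g (suc u) (suc v)
  swap : ∀ a b c d → (a + b) + (c + d) ≡ (a + c) + (b + d)
  swap = solve-∀

pairSum-*ˡ : ∀ {n} c (f : Fin n → Fin n → ℕ) → pairSum (λ u v → c * f u v) ≡ c * pairSum f
pairSum-*ˡ {zero}  c f = sym (ℕ.*-zeroʳ c)
pairSum-*ˡ {suc n} c f = trans
  (cong₂ _+_ (sym (*-distribˡ-sum c (λ v → f zero (suc v))))
             (pairSum-*ˡ c (λ u v → f (suc u) (suc v))))
  (sym (ℕ.*-distribˡ-+ c _ _))

pairSum-1 : ∀ n → pairSum {n} (λ _ _ → 1) ≡ n C 2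
pairSum-1 zero    = refl
pairSum-1 (suc n) = begin
  sum {n} (λ _ → 1) + pairSum {n} (λ _ _ → 1) ≡⟨ cong₂ _+_ (sum-const n 1) (pairSum-1 n) ⟩
  n * 1 + n C 2                               ≡⟨ cong (_+ n C 2) (ℕ.*-identityʳ n) ⟩
  n + n C 2                                   ≡⟨ cong (_+ n C 2) (nC1≡n n) ⟨
  n C 1 + n C 2                               ≡⟨ nCk+nC[k+1]≡[n+1]C[k+1] n 1 ⟩
  suc n C 2 ∎
  where open ≡-Reasoning

module _ {a p} {A : Set a} {P : Pred A p} (P? : Decidable P) where

  length-filter-tabulate : ∀ {n} (f : Fin n → A) →
    length (filter P? (tabulate f)) ≡ sum (ind ∘ does ∘ P? ∘ f)
  length-filter-tabulate {zero}  f = refl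
  length-filter-tabulate {suc n} f with does (P? (f zero))
  ... | true  = cong suc (length-filter-tabulate (f ∘ suc))
  ... | false = length-filter-tabulate (f ∘ suc)

length-filter-cartesianProduct :
  ∀ {a b p} {A : Set a} {B : Set b} {P : Pred (A × B) p} (P? : Decidable P)
  {m n} (f : Fin m → A) (g : Fin n → B) →
  length (filter P? (cartesianProduct (tabulate f) (tabulate g))) ≡
  sum (λ i → sum (λ j → ind (does (P? (f i , g j)))))
length-filter-cartesianProduct P? {zero}  f g = refl
length-filter-cartesianProduct P? {suc m} f g = begin
  length (filter P? (map (f zero ,_) (tabulate g) ++ rest))
    ≡⟨ cong length (List.filter-++ P? (map (f zero ,_) (tabulate g)) rest) ⟩
  length (filter P? (map (f zero ,_) (tabulate g)) ++ filter P? rest)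
    ≡⟨ List.length-++ (filter P? (map (f zero ,_) (tabulate g))) ⟩
  length (filter P? (map (f zero ,_) (tabulate g))) + length (filter P? rest)
    ≡⟨ cong₂ _+_ (cong (length ∘ filter P?) (List.map-tabulate g (f zero ,_)))
                 (length-filter-cartesianProduct P? (f ∘ suc) g) ⟩
  length (filter P? (tabulate ((f zero ,_) ∘ g))) + _
    ≡⟨ cong (_+ _) (length-filter-tabulate P? ((f zero ,_) ∘ g)) ⟩
  _ ∎
  where
  open ≡-Reasoning
  rest = cartesianProduct (tabulate (f ∘ suc)) (tabulate g)

-- The test `u < v` computes: it is `false` down the first column and `true` along the rest of the
-- first row, so a row and a column peel off exactly as in `pairSum`.
orderedSum≡pairSum : ∀ {n} (f : Fin n → Fin n → Bool) →
  sum (λ u → sum (λ v → ind (does (u Fin.<? v) ∧ f u v))) ≡ pairSum (λ u v → ind (f u v))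
orderedSum≡pairSum {zero}  f = refl
orderedSum≡pairSum {suc n} f =
  cong (sum (λ v → ind (f zero (suc v))) ℕ.+_) (orderedSum≡pairSum (λ u v → f (suc u) (suc v)))

edgeCount≡pairSum : ∀ {n} (G : Graph n) → edgeCount G ≡ pairSum (λ u v → ind (adj G u v))
edgeCount≡pairSum G = trans
  (length-filter-cartesianProduct (λ (u , v) → (u Fin.<? v) ×-dec Bool.T? (adj G u v))
    (λ u → u) (λ v → v))
  (orderedSum≡pairSum (adj G))

edgeCount≤nC2 : ∀ {n} (G : Graph n) → edgeCount G ≤ n C 2
edgeCount≤nC2 {n} G = begin
  edgeCount G                       ≡⟨ edgeCount≡pairSum G ⟩
  pairSum (λ u v → ind (adj G u v)) ≤⟨ pairSum-mono (λ u v _ → ind≤1 (adj G u v)) ⟩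
  pairSum {n} (λ _ _ → 1)           ≡⟨ pairSum-1 n ⟩
  n C 2 ∎
  where
  open ℕ.≤-Reasoning
  ind≤1 : ∀ b → ind b ≤ 1
  ind≤1 true  = ℕ.≤-refl
  ind≤1 false = z≤n

-- Averaging over all labellings

min≤mean : ∀ {k} (f : Fin (suc k) → ℕ) → ∃[ c ] suc k * f c ≤ sum f
min≤mean {zero}  f = zero , ℕ.≤-refl
min≤mean {suc k} f with min≤mean (f ∘ suc)
... | c , kfc≤ with ℕ.≤-total (f zero) (f (suc c))
... | inj₁ f0≤fc = zero , ℕ.+-monoʳ-≤ (f zero) (ℕ.≤-trans (ℕ.*-monoʳ-≤ (suc k) f0≤fc) kfc≤)
... | inj₂ fc≤f0 = suc c , ℕ.+-mono-≤ fc≤f0 kfc≤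

-- The method of conditional expectations; the unary weights w carry the cost of the pairs
-- meeting the vertices that have already been assigned.
labelling≤mean : ∀ {n k} .{{_ : NonZero k}} (w : Fin n → Fin k → ℕ)
  (c : Fin n → Fin n → Fin k → Fin k → ℕ) →
  ∃ λ (φ : Fin n → Fin k) →
    k * k * (sum (λ v → w v (φ v)) + pairSum (λ u v → c u v (φ u) (φ v))) ≤
    k * sum (λ v → sum (w v)) + pairSum (λ u v → sum (λ a → sum (c u v a)))
labelling≤mean {zero}  {suc k} w c = (λ ()) , ℕ.≤-reflexive (arith k)
  where
  arith : ∀ k → suc k * suc k * 0 ≡ suc k * 0 + 0
  arith = solve-∀
labelling≤mean {suc n} {K@(suc _)} w c = φ , (begin
  K * K * ((w zero c₀ + A) + (D + P))           ≡⟨ arith₁ K (w zero c₀) A D P ⟩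
  K * (K * w zero c₀) + K * K * ((A + D) + P)   ≡⟨ cong (λ s → K * (K * w zero c₀) + K * K * (s + P))
                                                     (∑-distrib-+ (λ v → w (suc v) (ψ v))
                                                                  (λ v → c zero (suc v) c₀ (ψ v))) ⟨
  K * (K * w zero c₀) + K * K * (sum (λ v → w′ v (ψ v)) + P)
    ≤⟨ ℕ.+-monoʳ-≤ (K * (K * w zero c₀)) ψ≤ ⟩
  K * (K * w zero c₀) + (K * sum (λ v → sum (w′ v)) + Q)
    ≡⟨ cong (λ s → K * (K * w zero c₀) + (K * s + Q))
         (trans (sum-cong-≗ (λ v → ∑-distrib-+ (w (suc v)) (c zero (suc v) c₀)))
                (∑-distrib-+ (λ v → sum (w (suc v))) (λ v → sum (c zero (suc v) c₀)))) ⟩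
  K * (K * w zero c₀) + (K * (W + E c₀) + Q)    ≡⟨ arith₂ K (w zero c₀) W (E c₀) Q ⟩
  K * (K * w zero c₀ + E c₀) + (K * W + Q)      ≤⟨ ℕ.+-monoˡ-≤ (K * W + Q) c₀≤ ⟩
  sum (λ a → K * w zero a + E a) + (K * W + Q)
    ≡⟨ cong (_+ (K * W + Q)) (trans (∑-distrib-+ (λ a → K * w zero a) E)
         (cong₂ _+_ (sym (*-distribˡ-sum K (w zero))) (∑-comm (λ a v → sum (c zero (suc v) a))))) ⟩
  (K * sum (w zero) + R) + (K * W + Q)          ≡⟨ arith₃ K (sum (w zero)) R W Q ⟩
  K * (sum (w zero) + W) + (R + Q)              ∎)
  where
  open ℕ.≤-Reasoning
  E : Fin K → ℕ
  E a = sum (λ v → sum (c zero (suc v) a))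
  -- `K * w zero a + E a` is `K` times the mean cost of all terms that involve the vertex `zero`
  -- once it has label `a`; the mean is over the label of the other endpoint.
  best = min≤mean (λ a → K * w zero a + E a)
  c₀ = best .proj₁
  c₀≤ = best .proj₂
  w′ : Fin n → Fin K → ℕ
  w′ v b = w (suc v) b + c zero (suc v) c₀ b
  rest = labelling≤mean w′ (λ u v → c (suc u) (suc v))
  ψ = rest .proj₁
  ψ≤ = rest .proj₂
  φ : Fin (suc n) → Fin K
  φ zero    = c₀
  φ (suc v) = ψ v
  A = sum (λ v → w (suc v) (ψ v))
  D = sum (λ v → c zero (suc v) c₀ (ψ v))
  P = pairSum (λ u v → c (suc u) (suc v) (ψ u) (ψ v))
  W = sum (λ v → sum (w (suc v)))
  Q = pairSum (λ u v → sum (λ a → sum (c (suc u) (suc v) a)))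
  R = sum (λ v → sum (λ a → sum (c zero (suc v) a)))
  arith₁ : ∀ k x a d p → k * k * ((x + a) + (d + p)) ≡ k * (k * x) + k * k * ((a + d) + p)
  arith₁ = solve-∀
  arith₂ : ∀ k x w e q → k * (k * x) + (k * (w + e) + q) ≡ k * (k * x + e) + (k * w + q)
  arith₂ = solve-∀
  arith₃ : ∀ k x r w q → (k * x + r) + (k * w + q) ≡ k * (x + w) + (r + q)
  arith₃ = solve-∀

-- Coloured regularity graphs and recolouring

data Colour : Set where
  white grey black : Colour

isWhite isBlack : Colour → Bool
isWhite white = true
isWhite _     = false
isBlack black = true
isBlack _     = false

recolour : Colour → Bool → Bool
recolour white _ = false
recolour grey  b = b
recolour black _ = true

cost : Bool → Colour → ℕ
cost b χ = ind (if b then isWhite χ else isBlack χ)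

-- The colour of a vertex a is colour a a.
record CRG (k : ℕ) : Set where
  field
    colour      : Fin k → Fin k → Colour
    colour-symm : ∀ a b → colour a b ≡ colour b a

open CRG public

-- Ordered pairs, diagonal included: averaged over all `φ`, the pair `φ u`, `φ v` is uniform on all
-- `k * k` of them.
weight : ∀ {k} → (Colour → Bool) → CRG k → ℕ
weight χ? R = sum λ a → sum λ b → ind (χ? (colour R a b))

recoloured : ∀ {n k} → CRG k → (Fin n → Fin k) → Graph n → Graph n
recoloured R φ G .adj u v =
  not (does (u Fin.≟ v)) ∧ recolour (colour R (φ u) (φ v)) (adj G u v)
recoloured R φ G .symm u v = cong₂ _∧_ (≟-symm u v)
  (cong₂ recolour (colour-symm R (φ u) (φ v)) (symm G u v))
  where
  ≟-symm : ∀ {n} (u v : Fin n) → not (does (u Fin.≟ v)) ≡ not (does (v Fin.≟ u))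
  ≟-symm u v with u Fin.≟ v
  ... | yes u≡v = cong not (sym (dec-true (v Fin.≟ u) (sym u≡v)))
  ... | no  u≢v = cong not (sym (dec-false (v Fin.≟ u) (u≢v ∘ sym)))
recoloured R φ G .irrefl v =
  cong (λ b → not b ∧ recolour (colour R (φ v) (φ v)) (adj G v v)) (dec-true (v Fin.≟ v) refl)

module _ {n k} (R : CRG k) (φ : Fin n → Fin k) (G : Graph n) where

  adj-recoloured : ∀ {u v} → u ≢ v →
    adj (recoloured R φ G) u v ≡ recolour (colour R (φ u) (φ v)) (adj G u v)
  adj-recoloured {u} {v} u≢v =
    cong (λ b → not b ∧ recolour (colour R (φ u) (φ v)) (adj G u v)) (dec-false (u Fin.≟ v) u≢v)

  edge⇒¬white : ∀ {u v} → adj (recoloured R φ G) u v ≡ true → colour R (φ u) (φ v) ≢ white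
  edge⇒¬white {u} {v} uv φuv≡white 
    with () ← trans (sym uv) (trans
                (cong (λ χ → not (does (u Fin.≟ v)) ∧ recolour χ (adj G u v)) φuv≡white)
                (Bool.∧-zeroʳ (not (does (u Fin.≟ v)))))

  -- Loops are non-edges even over a black vertex, hence `u ≢ v`. Two distinct vertices sent to the
  -- same black vertex do become adjacent.
  nonedge⇒¬black : ∀ {u v} → u ≢ v → adj (recoloured R φ G) u v ≡ false →
                   colour R (φ u) (φ v) ≢ black
  nonedge⇒¬black {u} {v} u≢v uv φuv≡black
    with () ← trans (sym uv) (trans (adj-recoloured u≢v)
                (cong (λ χ → recolour χ (adj G u v)) φuv≡black))

  dist-recoloured : dist G (recoloured R φ G) ≤
                    pairSum (λ u v → cost (adj G u v) (colour R (φ u) (φ v)))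
  dist-recoloured = begin
    dist G (recoloured R φ G)  ≡⟨ edgeCount≡pairSum (G △ recoloured R φ G) ⟩
    pairSum (λ u v → ind (adj G u v xor adj (recoloured R φ G) u v))
      ≤⟨ pairSum-mono (λ u v u≢v → ℕ.≤-reflexive (trans
           (cong (λ b → ind (adj G u v xor b)) (adj-recoloured u≢v))
           (xor-recolour (adj G u v) (colour R (φ u) (φ v))))) ⟩
    pairSum (λ u v → cost (adj G u v) (colour R (φ u) (φ v))) ∎
    where
    open ℕ.≤-Reasoning
    xor-recolour : ∀ b χ → ind (b xor recolour χ b) ≡ cost b χ
    xor-recolour true  white = refl
    xor-recolour true  grey  = refl
    xor-recolour true  black = refl
    xor-recolour false white = refl
    xor-recolour false grey  = refl
    xor-recolour false black = refl

-- Summed over all labels, an edge costs the white weight `4 * x` and a non-edge the black weight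
-- `x`, that is `x * (3 * ind + 1)` in both cases. Dividing by `k * k ≡ x * y` turns the ratio 4 : 1
-- into the numerator `3p + 1` and leaves `y` as the denominator.
cheap-recolouring : ∀ {k x y} .{{_ : NonZero k}} .{{_ : NonZero x}} (R : CRG k) →
  weight isWhite R ≡ 4 * x → weight isBlack R ≡ x → k * k ≡ x * y →
  ∀ {n} (G : Graph n) → ∃ λ (φ : Fin n → Fin k) →
  y * dist G (recoloured R φ G) ≤ 3 * edgeCount G + n C 2
cheap-recolouring {k} {x} {y} R white≡ black≡ kk≡xy {n} G = φ , ℕ.*-cancelˡ-≤ x (begin
  x * (y * d)                 ≡⟨ ℕ.*-assoc x y d ⟨
  x * y * d                   ≡⟨ cong (_* d) kk≡xy ⟨
  k * k * d                   ≤⟨ ℕ.*-monoʳ-≤ (k * k) (ℕ.≤-trans (dist-recoloured R φ G) (ℕ.m≤n+m _ _)) ⟩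
  k * k * (sum {n} (λ _ → 0) + pairSum (λ u v → c u v (φ u) (φ v)))
                              ≤⟨ labelling .proj₂ ⟩
  k * sum {n} (λ _ → sum {k} (λ _ → 0)) + pairSum (λ u v → sum (λ a → sum (c u v a)))
                              ≡⟨ cong₂ _+_ zeros (pairSum-cong pair-weight) ⟩
  pairSum (λ u v → x * (3 * ind (adj G u v) + 1))
                              ≡⟨ pairSum-*ˡ x (λ u v → 3 * ind (adj G u v) + 1) ⟩
  x * pairSum (λ u v → 3 * ind (adj G u v) + 1)
    ≡⟨ cong (x *_) (trans (pairSum-distrib-+ (λ u v → 3 * ind (adj G u v)) (λ _ _ → 1))
         (cong₂ _+_ (trans (pairSum-*ˡ 3 (λ u v → ind (adj G u v)))
                           (cong (3 *_) (sym (edgeCount≡pairSum G))))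
                    (pairSum-1 n))) ⟩
  x * (3 * edgeCount G + n C 2) ∎)
  where
  open ℕ.≤-Reasoning
  c : Fin n → Fin n → Fin k → Fin k → ℕ
  c u v a b = cost (adj G u v) (colour R a b)
  labelling = labelling≤mean (λ _ _ → 0) c
  φ = labelling .proj₁
  d = dist G (recoloured R φ G)
  zeros : k * sum {n} (λ _ → sum {k} (λ _ → 0)) ≡ 0
  zeros = trans (cong (k *_) (trans
    (sum-cong-≗ {n} (λ _ → trans (sum-const k 0) (ℕ.*-zeroʳ k)))
    (trans (sum-const n 0) (ℕ.*-zeroʳ n)))) (ℕ.*-zeroʳ k)
  arith : ∀ x → 4 * x ≡ x * (3 * 1 + 1)
  arith = solve-∀
  pair-weight : ∀ u v → sum (λ a → sum (c u v a)) ≡ x * (3 * ind (adj G u v) + 1)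
  pair-weight u v with adj G u v
  ... | true  = trans white≡ (arith x)
  ... | false = trans black≡ (sym (ℕ.*-identityʳ x))

-- Avoiding the forbidden graph, and the case `t = 2`

-- Quantifying over every `φ` leaves the choice of the labelling to the cost argument.
Avoids : ∀ {h k} → CRG k → Graph h → Set
Avoids {k = k} R H = ∀ {n} (φ : Fin n → Fin k) (G : Graph n) → Holds (Forb H) (recoloured R φ G)

-- For t = 2 a 4-regular graph on 7 vertices with codegrees at most 2 does not exist; over this R
-- the recoloured graphs are split graphs, and 9 takes the place of t + 5.
splitCRG : CRG 3
splitCRG = record
  { colour      = λ a b → χ (isClique a) (isClique b)
  ; colour-symm = λ a b → χ-symm (isClique a) (isClique b)
  }
  module Split where
  isClique : Fin 3 → Bool
  isClique (suc (suc zero)) = true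
  isClique _                = false

  χ : Bool → Bool → Colour
  χ false false = white
  χ true  true  = black
  χ _     _     = grey

  χ-symm : ∀ a b → χ a b ≡ χ b a
  χ-symm false false = refl
  χ-symm false true  = refl
  χ-symm true  false = refl
  χ-symm true  true  = refl

-- `K 2 2` is a 4-cycle. In each of its two non-adjacent pairs some vertex lies outside the clique;
-- these two vertices are adjacent, yet both belong to the independent part.
splitCRG-avoids-K22 : Avoids splitCRG (K 2 2)
splitCRG-avoids-K22 φ G (f , f-inj , f-adj) = absurd
  (isClique (φ (f u₁))) (isClique (φ (f u₂))) (isClique (φ (f w₁))) (isClique (φ (f w₂)))
  (nonedge⇒¬black splitCRG φ G (λ eq → u₁≢u₂ (f-inj eq)) (f-adj u₁ u₂))
  (nonedge⇒¬black splitCRG φ G (λ eq → w₁≢w₂ (f-inj eq)) (f-adj w₁ w₂))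
  (edge⇒¬white splitCRG φ G (f-adj u₁ w₁)) (edge⇒¬white splitCRG φ G (f-adj u₁ w₂))
  (edge⇒¬white splitCRG φ G (f-adj u₂ w₁)) (edge⇒¬white splitCRG φ G (f-adj u₂ w₂))
  where
  open Split
  u₁ u₂ w₁ w₂ : Fin 4
  u₁ = zero
  u₂ = suc zero
  w₁ = suc (suc zero)
  w₂ = suc (suc (suc zero))
  u₁≢u₂ : u₁ ≢ u₂
  u₁≢u₂ ()
  w₁≢w₂ : w₁ ≢ w₂
  w₁≢w₂ ()
  absurd : ∀ a b c d → χ a b ≢ black → χ c d ≢ black → χ a c ≢ white → χ a d ≢ white →
           χ b c ≢ white → χ b d ≢ white → ⊥
  absurd true  true  _     _     ab _  _  _  _  _  = ab refl
  absurd _     _     true  true  _  cd _  _  _  _  = cd refl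
  absurd false _     false _     _  _  ac _  _  _  = ac refl
  absurd false _     _     false _  _  _  ad _  _  = ad refl
  absurd _     false false _     _  _  _  _  bc _  = bc refl
  absurd _     false _     false _  _  _  _  _  bd = bd refl

-- 4-regular graphs with small codegrees

sum-δ : ∀ {n} (a : Fin n) → sum (λ b → ind (does (a Fin.≟ b))) ≡ 1
sum-δ {suc n} zero    = cong suc (trans (sum-const n 0) (ℕ.*-zeroʳ n))
sum-δ {suc n} (suc a) = sum-δ a

sum-splitAt : ∀ m {n} (g : Fin m ⊎ Fin n → ℕ) →
              sum (g ∘ splitAt m) ≡ sum (g ∘ inj₁) + sum (g ∘ inj₂)
sum-splitAt zero    g = refl
sum-splitAt (suc m) g = trans (cong (g (inj₁ zero) ℕ.+_) (sum-splitAt m (g ∘ map₁ suc)))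
  (sym (ℕ.+-assoc (g (inj₁ zero)) _ _))

-- The value at `c zero` is split off, and injectivity lets `punchOut` renumber the remaining
-- indices. With an indicator for `g`, this bounds the number of distinct labels by the size of a
-- set that contains them.
sum-injective : ∀ {m n} (g : Fin n → ℕ) (c : Fin m → Fin n) → Injective _≡_ _≡_ c →
                sum (g ∘ c) ≤ sum g
sum-injective {zero}          g c c-inj = z≤n
sum-injective {suc m} {zero}  g c c-inj with () ← c zero
sum-injective {suc m} {suc n} g c c-inj = begin
  g (c zero) + sum (g ∘ c ∘ suc)
    ≡⟨ cong (g (c zero) ℕ.+_) (sum-cong-≗ (λ i → cong g (sym (Fin.punchIn-punchOut (c₀≢ i))))) ⟩
  g (c zero) + sum (g ∘ punchIn (c zero) ∘ c′)
    ≤⟨ ℕ.+-monoʳ-≤ (g (c zero)) (sum-injective (g ∘ punchIn (c zero)) c′ c′-inj) ⟩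
  g (c zero) + sum (g ∘ punchIn (c zero))
    ≡⟨ sum-remove {i = c zero} g ⟨
  sum g ∎
  where
  open ℕ.≤-Reasoning
  c₀≢ : ∀ i → c zero ≢ c (suc i)
  c₀≢ i eq with () ← c-inj eq
  c′ : Fin m → Fin n
  c′ i = punchOut (c₀≢ i)
  c′-inj : Injective _≡_ _≡_ c′
  c′-inj {i} {j} eq = Fin.suc-injective (c-inj (Fin.punchOut-injective (c₀≢ i) (c₀≢ j) eq))

degree : ∀ {n} → Graph n → Fin n → ℕ
degree G a = sum λ c → ind (adj G a c)

codegree : ∀ {n} → Graph n → Fin n → Fin n → ℕ
codegree G a b = sum λ c → ind (adj G a c ∧ adj G b c)

-- The disjunction keeps the codegree condition decidable as it stands, so that small cases can be
-- settled by evaluation.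
record Sparse4Regular {n} (W : Graph n) : Set where
  constructor _,_
  field
    4-regular  : ∀ a → degree W a ≡ 4
    codegree≤2 : ∀ a b → a ≡ b ⊎ codegree W a b ≤ 2

open Sparse4Regular

circulant : ∀ j → Graph (8 + j)
circulant j = record
  { adj    = λ u v → near ∣ toℕ u - toℕ v ∣
  ; symm   = λ u v → cong near (ℕ.∣-∣-comm (toℕ u) (toℕ v))
  ; irrefl = λ v → cong near (ℕ.∣n-n∣≡0 (toℕ v))
  }
  where
  near : ℕ → Bool
  -- On `8 + j` vertices the differences `6 + j` and `7 + j` are -2 and -1 around the cycle, so each
  -- vertex is joined to the two nearest on either side.
  near d = (d ≡ᵇ 1) ∨ (d ≡ᵇ 2) ∨ (d ≡ᵇ 6 + j) ∨ (d ≡ᵇ 7 + j)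

-- Common neighbours of two vertices at difference d correspond to ways of writing d as s - s′ with
-- s and s′ among ±1, ±2: two ways for ±1 and ±3, one for ±2 and ±4. Modulo 8 or more, only 4 and -4
-- can coincide, so no nonzero d has more than two.
circulant-sparse : ∀ (j : Fin 8) → Sparse4Regular (circulant (toℕ j))
circulant-sparse j = check j .proj₁ , check j .proj₂
  where
  check = from-yes (Fin.all? {n = 8} λ j →
    (Fin.all? λ a → degree (circulant (toℕ j)) a ℕ.≟ 4)
    ×-dec
    (Fin.all? λ a → Fin.all? λ b → (a Fin.≟ b) ⊎-dec (codegree (circulant (toℕ j)) a b ≤? 2)))

infixr 5 _⊕_

_⊕_ : ∀ {m n} → Graph m → Graph n → Graph (m + n)
_⊕_ {m} {n} G H = record
  { adj    = λ u v → adj⊎ (splitAt m u) (splitAt m v)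
  ; symm   = λ u v → symm⊎ (splitAt m u) (splitAt m v)
  ; irrefl = λ v → irrefl⊎ (splitAt m v)
  }
  module Union where
  adj⊎ : Fin m ⊎ Fin n → Fin m ⊎ Fin n → Bool
  adj⊎ (inj₁ u) (inj₁ v) = adj G u v
  adj⊎ (inj₂ u) (inj₂ v) = adj H u v
  adj⊎ _        _        = false

  symm⊎ : ∀ u v → adj⊎ u v ≡ adj⊎ v u
  symm⊎ (inj₁ u) (inj₁ v) = symm G u v
  symm⊎ (inj₂ u) (inj₂ v) = symm H u v
  symm⊎ (inj₁ _) (inj₂ _) = refl
  symm⊎ (inj₂ _) (inj₁ _) = refl

  irrefl⊎ : ∀ v → adj⊎ v v ≡ false
  irrefl⊎ (inj₁ v) = irrefl G v
  irrefl⊎ (inj₂ v) = irrefl H v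

-- Vertices from different summands have no common neighbour; for vertices of one summand the other
-- contributes nothing.
⊕-sparse : ∀ {m n} {G : Graph m} {H : Graph n} →
           Sparse4Regular G → Sparse4Regular H → Sparse4Regular (G ⊕ H)
⊕-sparse {m} {n} {G} {H} G-sparse H-sparse = regular , sparse
  where
  open Union G H
  zeros : ∀ k → sum {k} (λ _ → 0) ≡ 0
  zeros k = trans (sum-const k 0) (ℕ.*-zeroʳ k)

  degree⊎ : ∀ x → sum (λ c → ind (adj⊎ x (inj₁ c))) + sum (λ c → ind (adj⊎ x (inj₂ c))) ≡ 4
  degree⊎ (inj₁ a) = cong₂ _+_ (4-regular G-sparse a) (zeros n)
  degree⊎ (inj₂ a) = cong₂ _+_ (zeros m) (4-regular H-sparse a)

  regular : ∀ a → degree (G ⊕ H) a ≡ 4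
  regular a = trans (sum-splitAt m (λ c → ind (adj⊎ (splitAt m a) c))) (degree⊎ (splitAt m a))

  codegree⊎ : ∀ x y → x ≡ y ⊎
    sum (λ c → ind (adj⊎ x (inj₁ c) ∧ adj⊎ y (inj₁ c))) +
    sum (λ c → ind (adj⊎ x (inj₂ c) ∧ adj⊎ y (inj₂ c))) ≤ 2
  codegree⊎ (inj₁ a) (inj₁ b) with codegree≤2 G-sparse a b
  ... | inj₁ a≡b = inj₁ (cong inj₁ a≡b)
  ... | inj₂ ≤2  = inj₂ (ℕ.+-mono-≤ ≤2 (ℕ.≤-reflexive (zeros n)))
  codegree⊎ (inj₂ a) (inj₂ b) with codegree≤2 H-sparse a b
  ... | inj₁ a≡b = inj₁ (cong inj₂ a≡b)
  ... | inj₂ ≤2  = inj₂ (ℕ.+-mono-≤ (ℕ.≤-reflexive (zeros m)) ≤2)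
  codegree⊎ (inj₁ a) (inj₂ b) = inj₂ (ℕ.≤-trans (ℕ.≤-reflexive (cong₂ _+_
    (trans (sum-cong-≗ (λ c → cong ind (Bool.∧-zeroʳ (adj G a c)))) (zeros m)) (zeros n))) z≤n)
  codegree⊎ (inj₂ a) (inj₁ b) = inj₂ (ℕ.≤-trans (ℕ.≤-reflexive (cong₂ _+_ (zeros m)
    (trans (sum-cong-≗ (λ c → cong ind (Bool.∧-zeroʳ (adj H a c)))) (zeros n)))) z≤n)

  sparse : ∀ a b → a ≡ b ⊎ codegree (G ⊕ H) a b ≤ 2
  sparse a b with codegree⊎ (splitAt m a) (splitAt m b)
  ... | inj₁ eq = inj₁ (trans (sym (Fin.join-splitAt m n a))
          (trans (cong (join m n) eq) (Fin.join-splitAt m n b)))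
  ... | inj₂ ≤2 = inj₂ (ℕ.≤-trans (ℕ.≤-reflexive
          (sum-splitAt m (λ c → ind (adj⊎ (splitAt m a) c ∧ adj⊎ (splitAt m b) c)))) ≤2)

-- Circulants on 8, …, 15 vertices are checked by computation; disjoint unions reach the larger
-- orders.
sparse4Regular : ∀ k → ∃ λ (W : Graph (8 + k)) → Sparse4Regular W
sparse4Regular 0 = circulant 0 , circulant-sparse 0F
sparse4Regular 1 = circulant 1 , circulant-sparse 1F
sparse4Regular 2 = circulant 2 , circulant-sparse 2F
sparse4Regular 3 = circulant 3 , circulant-sparse 3F
sparse4Regular 4 = circulant 4 , circulant-sparse 4F
sparse4Regular 5 = circulant 5 , circulant-sparse 5F
sparse4Regular 6 = circulant 6 , circulant-sparse 6F
sparse4Regular 7 = circulant 7 , circulant-sparse 7F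
sparse4Regular (suc (suc (suc (suc (suc (suc (suc (suc k)))))))) with sparse4Regular k
... | W , W-sparse = circulant 0 ⊕ W , ⊕-sparse (circulant-sparse 0F) W-sparse

-- The coloured regularity graph for `t ≥ 3`

blackCRG : ∀ {k} → Graph k → CRG k
blackCRG W = record
  { colour      = λ a b → if does (a Fin.≟ b) then black else if adj W a b then white else grey
  ; colour-symm = colour-symm′
  }
  where
  colour-symm′ : ∀ a b → (if does (a Fin.≟ b) then black else if adj W a b then white else grey) ≡
                         (if does (b Fin.≟ a) then black else if adj W b a then white else grey)
  colour-symm′ a b with a Fin.≟ b
  ... | yes a≡b rewrite dec-true (b Fin.≟ a) (sym a≡b) = refl
  ... | no  a≢b rewrite dec-false (b Fin.≟ a) (a≢b ∘ sym) | symm W a b = refl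

module _ {k} (W : Graph k) where

  isWhite-blackCRG : ∀ a b → isWhite (colour (blackCRG W) a b) ≡ adj W a b
  isWhite-blackCRG a b with a Fin.≟ b
  ... | yes refl = sym (irrefl W a)
  ... | no  _ with adj W a b
  ...   | true  = refl
  ...   | false = refl

  isBlack-blackCRG : ∀ a b → isBlack (colour (blackCRG W) a b) ≡ does (a Fin.≟ b)
  isBlack-blackCRG a b with does (a Fin.≟ b) | adj W a b
  ... | true  | _     = refl
  ... | false | true  = refl
  ... | false | false = refl

  -- When not adjacent in `W`, `a` and `b` themselves count: an edge may join two vertices over the
  -- same black label.
  outside : Fin k → Fin k → Fin k → ℕ
  outside a b c = ind (not (adj W a c) ∧ not (adj W b c))

  module _ (W-sparse : Sparse4Regular W) where

    whiteWeight-blackCRG : weight isWhite (blackCRG W) ≡ 4 * k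
    whiteWeight-blackCRG = trans
      (sum-cong-≗ λ a → trans (sum-cong-≗ λ b → cong ind (isWhite-blackCRG a b)) (4-regular W-sparse a))
      (trans (sum-const k 4) (ℕ.*-comm k 4))

    blackWeight-blackCRG : weight isBlack (blackCRG W) ≡ k
    blackWeight-blackCRG = trans
      (sum-cong-≗ λ a → trans (sum-cong-≗ λ b → cong ind (isBlack-blackCRG a b)) (sum-δ a))
      (trans (sum-const k 1) (ℕ.*-identityʳ k))

    -- Inclusion-exclusion, summed over `c`: the vertices outside both neighbourhoods plus the two
    -- degrees make `k` plus the codegree. Adding 2 to both sides avoids truncated subtraction.
    sum-outside : ∀ {a b} → a ≢ b →
      sum (outside a b) + 6 ≤ k
    sum-outside {a} {b} a≢b with codegree≤2 W-sparse a b
    ... | inj₁ a≡b = ⊥-elim (a≢b a≡b)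
    ... | inj₂ ≤2  = ℕ.+-cancelʳ-≤ 2 _ _ (begin
      N + 6 + 2                                 ≡⟨ ℕ.+-assoc N 6 2 ⟩
      N + (4 + 4)
        ≡⟨ cong₂ (λ x y → N + (x + y)) (4-regular W-sparse a) (4-regular W-sparse b) ⟨
      N + (degree W a + degree W b)
        ≡⟨ cong (N ℕ.+_) (∑-distrib-+ (λ c → ind (adj W a c)) (λ c → ind (adj W b c))) ⟨
      N + sum (λ c → ind (adj W a c) + ind (adj W b c))
        ≡⟨ ∑-distrib-+ (outside a b) (λ c → ind (adj W a c) + ind (adj W b c)) ⟨
      sum (λ c → outside a b c + (ind (adj W a c) + ind (adj W b c)))
        ≡⟨ sum-cong-≗ (λ c → inclusion-exclusion (adj W a c) (adj W b c)) ⟩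
      sum (λ c → 1 + ind (adj W a c ∧ adj W b c))
        ≡⟨ ∑-distrib-+ (λ _ → 1) (λ c → ind (adj W a c ∧ adj W b c)) ⟩
      sum {k} (λ _ → 1) + codegree W a b
        ≡⟨ cong (_+ codegree W a b) (trans (sum-const k 1) (ℕ.*-identityʳ k)) ⟩
      k + codegree W a b                        ≤⟨ ℕ.+-monoʳ-≤ k ≤2 ⟩
      k + 2 ∎)
      where
      open ℕ.≤-Reasoning
      N = sum (outside a b)
      inclusion-exclusion : ∀ x y → ind (not x ∧ not y) + (ind x + ind y) ≡ 1 + ind (x ∧ y)
      inclusion-exclusion true  true  = refl
      inclusion-exclusion true  false = refl
      inclusion-exclusion false true  = refl
      inclusion-exclusion false false = refl

    blackCRG-avoids-K2t : ∀ t → k ≡ 5 + t → Avoids (blackCRG W) (K 2 t)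
    blackCRG-avoids-K2t t k≡5+t φ G (f , f-inj , f-adj) = ℕ.<-irrefl refl (begin-strict
      5 + t      <⟨ ℕ.n<1+n (5 + t) ⟩
      6 + t      ≡⟨ ℕ.+-comm 6 t ⟩
      t + 6      ≤⟨ ℕ.+-monoˡ-≤ 6 t≤ ⟩
      sum (outside a b) + 6 ≤⟨ sum-outside (distinct (λ ()) refl) ⟩
      k          ≡⟨ k≡5+t ⟩
      5 + t      ∎)
      where
      open ℕ.≤-Reasoning
      a b : Fin k
      a = φ (f zero)
      b = φ (f (suc zero))
      c : Fin t → Fin k
      c i = φ (f (suc (suc i)))

      -- Equal labels would form a black pair and force an edge.
      distinct : ∀ {x y} → x ≢ y → adj (K 2 t) x y ≡ false → φ (f x) ≢ φ (f y)
      distinct {x} {y} x≢y xy φx≡φy = nonedge⇒¬black (blackCRG W) φ G (x≢y ∘ f-inj)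
        (trans (f-adj x y) xy) (cong (if_then black else _) (dec-true (φ (f x) Fin.≟ φ (f y)) φx≡φy))

      -- An edge cannot lie over a white pair, and the white pairs are the edges of `W`.
      nonadjacent : ∀ {x y} → adj (K 2 t) x y ≡ true → adj W (φ (f x)) (φ (f y)) ≡ false
      nonadjacent {x} {y} xy = trans (sym (isWhite-blackCRG (φ (f x)) (φ (f y))))
        (¬white (edge⇒¬white (blackCRG W) φ G (trans (f-adj x y) xy)))
        where
        ¬white : ∀ {χ} → χ ≢ white → isWhite χ ≡ false
        ¬white {white} χ≢white = ⊥-elim (χ≢white refl)
        ¬white {grey}  _       = refl
        ¬white {black} _       = refl

      c-inj : Injective _≡_ _≡_ c
      c-inj {i} {j} eq with i Fin.≟ j
      ... | yes i≡j = i≡j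
      ... | no  i≢j = ⊥-elim (distinct (i≢j ∘ Fin.suc-injective ∘ Fin.suc-injective) refl eq)

      t≤ : t ≤ sum (outside a b)
      t≤ = begin
        t               ≡⟨ ℕ.*-identityʳ t ⟨
        t * 1           ≡⟨ sum-const t 1 ⟨
        sum {t} (λ _ → 1)
          ≡⟨ sum-cong-≗ (λ i → cong₂ (λ x y → ind (not x ∧ not y))
               (nonadjacent {zero} {suc (suc i)} refl) (nonadjacent {suc zero} {suc (suc i)} refl)) ⟨
        sum (outside a b ∘ c)
          ≤⟨ sum-injective (outside a b) c c-inj ⟩
        sum (outside a b) ∎

-- Both constructions in one bound, valid for every order `n`: this is all that the limit argument
-- uses about `K 2 t`.
recolouring : ∀ t → 2 ≤ t → ∀ {n} (G : Graph n) → ∃ λ (G′ : Graph n) →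
  Holds (Forb (K 2 t)) G′ × (5 + t) * dist G G′ ≤ 3 * edgeCount G + n C 2
recolouring 0 () G
recolouring 1 (s≤s ()) G
recolouring 2 _ {n} G = recoloured splitCRG φ G , splitCRG-avoids-K22 φ G ,
  ℕ.≤-trans (ℕ.*-monoˡ-≤ (dist G (recoloured splitCRG φ G)) (ℕ.m≤m+n 7 2)) φ-cheap
  where
  -- Of the nine ordered pairs of labels four are white and one is black; the resulting factor 9 is
  -- then weakened to 7.
  cheap = cheap-recolouring {x = 1} {y = 9} splitCRG refl refl refl G
  φ = cheap .proj₁
  φ-cheap = cheap .proj₂
recolouring (suc (suc (suc t))) _ {n} G =
  -- Here `t` is three less than the size of the large part, so the order `8 + t` of `W` is
  -- `5 + (3 + t)`.
  recoloured (blackCRG W) φ G , blackCRG-avoids-K2t W W-sparse (3 + t) refl φ G , φ-cheap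
  where
  W = sparse4Regular t .proj₁
  W-sparse = sparse4Regular t .proj₂
  cheap = cheap-recolouring (blackCRG W) (whiteWeight-blackCRG W W-sparse)
            (blackWeight-blackCRG W W-sparse) refl G
  φ = cheap .proj₁
  φ-cheap = cheap .proj₂

-- Graphs with a prescribed number of edges

cone : ∀ {n} → (Fin n → Bool) → Graph n → Graph (suc n)
cone {n} N G = record { adj = adj′ ; symm = symm′ ; irrefl = irrefl′ }
  where
  adj′ : Fin (suc n) → Fin (suc n) → Bool
  adj′ zero    zero    = false
  adj′ zero    (suc v) = N v
  adj′ (suc u) zero    = N u
  adj′ (suc u) (suc v) = adj G u v
  symm′ : ∀ u v → adj′ u v ≡ adj′ v u
  symm′ zero    zero    = refl
  symm′ zero    (suc v) = refl
  symm′ (suc u) zero    = refl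
  symm′ (suc u) (suc v) = symm G u v
  irrefl′ : ∀ v → adj′ v v ≡ false
  irrefl′ zero    = refl
  irrefl′ (suc v) = irrefl G v

sum-<ᵇ : ∀ n r → sum {n} (λ v → ind (toℕ v <ᵇ r)) ≡ n ⊓ r
sum-<ᵇ zero    r       = refl
sum-<ᵇ (suc n) zero    = trans (sum-const n 0) (ℕ.*-zeroʳ n)
sum-<ᵇ (suc n) (suc r) = cong suc (sum-<ᵇ n r)

[1+n]C2≡n+nC2 : ∀ n → suc n C 2 ≡ n + n C 2
[1+n]C2≡n+nC2 n = trans (sym (nCk+nC[k+1]≡[n+1]C[k+1] n 1)) (cong (_+ n C 2) (nC1≡n n))

-- Greedy: the new vertex takes `n ⊓ k` edges and the other `k ∸ n` go to the graph on the remaining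
-- vertices, where they fit because `suc n C 2` is `n + n C 2`.
graph-with-edges : ∀ n k → k ≤ n C 2 → ∃ λ (G : Graph n) → edgeCount G ≡ k
graph-with-edges zero    k k≤ = record { adj = λ () ; symm = λ () ; irrefl = λ () } , sym (ℕ.n≤0⇒n≡0 k≤)
graph-with-edges (suc n) k k≤
  with graph-with-edges n (k ∸ n) (ℕ.m≤n+o⇒m∸n≤o k n (subst (k ≤_) ([1+n]C2≡n+nC2 n) k≤))
... | G , G-edges = cone (λ v → toℕ v <ᵇ k) G , (begin
  edgeCount (cone (λ v → toℕ v <ᵇ k) G)   ≡⟨ edgeCount≡pairSum (cone (λ v → toℕ v <ᵇ k) G) ⟩
  sum (λ v → ind (toℕ {n} v <ᵇ k)) + pairSum (λ u v → ind (adj G u v))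
    ≡⟨ cong₂ _+_ (sum-<ᵇ n k) (trans (sym (edgeCount≡pairSum G)) G-edges) ⟩
  n ⊓ k + (k ∸ n)                         ≡⟨ ℕ.m⊓n+n∸m≡n n k ⟩
  k ∎)
  where open ≡-Reasoning

-- Minima and maxima under double negation

-- `P` need not be decidable, so no search is possible; but if there were no minimum, strong
-- induction would refute `P` everywhere.
¬¬-min : ∀ {P : ℕ → Set} {d} → P d → ¬ ¬ ∃ (IsMin P)
¬¬-min {P} {d} Pd ¬min = <-rec (¬_ ∘ P) none d Pd
  where
  none : ∀ d → (∀ {j} → j < d → ¬ P j) → ¬ P d
  none d below Pd = ¬min (d , Pd , λ j Pj → ℕ.≮⇒≥ λ j<d → below j<d Pj)

-- The reflection `j ↦ b ∸ j` turns a maximum below `b` into a minimum.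
¬¬-max : ∀ {P : ℕ → Set} {d} b → (∀ j → P j → j ≤ b) → P d → ¬ ¬ ∃ (IsMax P)
¬¬-max {P} {d} b P≤b Pd ¬max = ¬¬-min {λ i → ∃ λ j → P j × i ≡ b ∸ j} (d , Pd , refl)
  λ { (_ , (j , Pj , refl) , least) → ¬max (j , Pj , λ i Pi →
      ℕ.≮⇒≥ λ j<i → ℕ.<⇒≱ (ℕ.∸-monoʳ-< j<i (P≤b i Pi)) (least (b ∸ i) (i , Pi , refl))) }

-- Order on the Cauchy reals

-- Reduces a linear inequality to a sum of known ones and an identity for the ring solver.
≤-from-difference : ∀ {x y} l r → l ℚ.≤ r → y ℚ.- x ≡ r ℚ.- l → x ℚ.≤ y
≤-from-difference {x} {y} l r l≤r eq = begin
  x                   ≡⟨ solve 2 (λ x l → x := l :+ (x :- l)) refl x l ⟩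
  l ℚ.+ (x ℚ.- l)     ≤⟨ ℚ.+-monoˡ-≤ (x ℚ.- l) l≤r ⟩
  r ℚ.+ (x ℚ.- l)     ≡⟨ solve 3 (λ x l r → r :+ (x :- l) := (r :- l) :+ x) refl x l r ⟩
  (r ℚ.- l) ℚ.+ x     ≡⟨ cong (ℚ._+ x) eq ⟨
  (y ℚ.- x) ℚ.+ x     ≡⟨ solve 2 (λ x y → (y :- x) :+ x := y) refl x y ⟩
  y                   ∎
  where
  open ℚ.≤-Reasoning
  open +-*-Solver

*-pos : ∀ {p q} → 0ℚ ℚ.< p → 0ℚ ℚ.< q → 0ℚ ℚ.< p ℚ.* q
*-pos {p} {q} 0<p 0<q = ℚ.positive⁻¹ (p ℚ.* q) {{ℚ.pos*pos⇒pos p {{ℚ.positive 0<p}} q {{ℚ.positive 0<q}}}}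

p≤∣p∣ : ∀ p → p ℚ.≤ ℚ.∣ p ∣
p≤∣p∣ p with ℚ.≤-total 0ℚ p
... | inj₁ 0≤p = ℚ.≤-reflexive (sym (ℚ.0≤p⇒∣p∣≡p 0≤p))
... | inj₂ p≤0 = ℚ.≤-trans p≤0 (ℚ.0≤∣p∣ p)

cauchy-≤ : ∀ x δ → 0ℚ ℚ.< δ →
  ∃[ N ] (∀ m n → N ≤ m → N ≤ n → approx x m ℚ.≤ approx x n ℚ.+ δ)
cauchy-≤ x δ 0<δ = cauchy x δ 0<δ .proj₁ , λ m n N≤m N≤n →
  ≤-from-difference (approx x m ℚ.- approx x n) δ
    (ℚ.≤-trans (p≤∣p∣ _) (cauchy x δ 0<δ .proj₂ m n N≤m N≤n))
    (solve 3 (λ a b d → (b :+ d) :- a := d :- (a :- b)) refl (approx x m) (approx x n) δ)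
  where open +-*-Solver

≤ℝ-trans : ∀ {x y z} → x ≤ℝ y → y ≤ℝ z → x ≤ℝ z
≤ℝ-trans {x} {y} {z} x≤y y≤z ε 0<ε = x≤′ .proj₁ ⊔ y≤′ .proj₁ , λ n N≤n →
  ≤-from-difference (approx x n ℚ.+ approx y n) ((approx y n ℚ.+ ½ ℚ.* ε) ℚ.+ (approx z n ℚ.+ ½ ℚ.* ε))
    (ℚ.+-mono-≤ (x≤′ .proj₂ n (ℕ.m⊔n≤o⇒m≤o _ _ N≤n)) (y≤′ .proj₂ n (ℕ.m⊔n≤o⇒n≤o _ _ N≤n)))
    (solve 4 (λ x y z e → (z :+ e) :- x :=
       ((y :+ con ½ :* e) :+ (z :+ con ½ :* e)) :- (x :+ y)) refl (approx x n) (approx y n) (approx z n) ε)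
  where
  open +-*-Solver
  0<½ε = *-pos {½} {ε} (ℚ.positive⁻¹ ½) 0<ε
  x≤′ = x≤y (½ ℚ.* ε) 0<½ε
  y≤′ = y≤z (½ ℚ.* ε) 0<½ε

<ℝ⇒≱ℝ : ∀ {x y} → x <ℝ y → ¬ (y ≤ℝ x)
<ℝ⇒≱ℝ {x} {y} (ε , 0<ε , N , gap) y≤x = ℚ.<-irrefl refl (ℚ.<-≤-trans 0<½ε
  (≤-from-difference ((approx x n ℚ.+ ε) ℚ.+ approx y n) (approx y n ℚ.+ (approx x n ℚ.+ ½ ℚ.* ε))
    (ℚ.+-mono-≤ (gap n (ℕ.m≤m⊔n N _)) (y≤′ .proj₂ n (ℕ.m≤n⊔m N _)))
    (solve 3 (λ x y e → con 0ℚ :- con ½ :* e := (y :+ (x :+ con ½ :* e)) :- ((x :+ e) :+ y))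
       refl (approx x n) (approx y n) ε)))
  where
  open +-*-Solver
  0<½ε = *-pos {½} {ε} (ℚ.positive⁻¹ ½) 0<ε
  y≤′ = y≤x (½ ℚ.* ε) 0<½ε
  n = N ⊔ y≤′ .proj₁

-- From the index `N` on, both sequences stay within `δ` of their values there, and those two
-- rationals can be compared. A gap above `3δ` at `N` leaves at least `δ` at all later indices,
-- which is `x <ℝ y`; a smaller gap grows to at most `5δ`, hence the choice of `δ` as a fifth of
-- `ε`.
≮ℝ⇒≥ℝ : ∀ {x y} → ¬ (x <ℝ y) → y ≤ℝ x
≮ℝ⇒≥ℝ {x} {y} x≮y ε 0<ε = N , bound
  where
  open +-*-Solver
  δ = (+ 1 / 5) ℚ.* ε
  0<δ = *-pos {+ 1 / 5} {ε} (ℚ.positive⁻¹ (+ 1 / 5)) 0<ε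
  x-near = cauchy-≤ x δ 0<δ
  y-near = cauchy-≤ y δ 0<δ
  N = x-near .proj₁ ⊔ y-near .proj₁
  Nx≤ : ∀ {n} → N ≤ n → x-near .proj₁ ≤ n
  Nx≤ = ℕ.m⊔n≤o⇒m≤o _ _
  Ny≤ : ∀ {n} → N ≤ n → y-near .proj₁ ≤ n
  Ny≤ = ℕ.m⊔n≤o⇒n≤o _ _
  xN = approx x N
  yN = approx y N
  bound : ∀ n → N ≤ n → approx y n ℚ.≤ approx x n ℚ.+ ε
  bound n N≤n with yN ℚ.≤? xN ℚ.+ (δ ℚ.+ δ ℚ.+ δ)
  ... | yes yN≤ = ≤-from-difference
    (approx y n ℚ.+ (yN ℚ.+ xN))
    ((yN ℚ.+ δ) ℚ.+ ((xN ℚ.+ (δ ℚ.+ δ ℚ.+ δ)) ℚ.+ (approx x n ℚ.+ δ)))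
    (ℚ.+-mono-≤ (y-near .proj₂ n N (Ny≤ N≤n) (Ny≤ ℕ.≤-refl))
      (ℚ.+-mono-≤ yN≤ (x-near .proj₂ N n (Nx≤ ℕ.≤-refl) (Nx≤ N≤n))))
    (solve 5 (λ x y xN yN e → let d = con (+ 1 / 5) :* e in
      (x :+ e) :- y := ((yN :+ d) :+ ((xN :+ (d :+ d :+ d)) :+ (x :+ d))) :- (y :+ (yN :+ xN)))
      refl (approx x n) (approx y n) xN yN ε)
  ... | no yN≰ = ⊥-elim (x≮y (δ , 0<δ , N , λ i N≤i → ≤-from-difference
    (approx x i ℚ.+ ((xN ℚ.+ (δ ℚ.+ δ ℚ.+ δ)) ℚ.+ yN))
    ((xN ℚ.+ δ) ℚ.+ (yN ℚ.+ (approx y i ℚ.+ δ)))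
    (ℚ.+-mono-≤ (x-near .proj₂ i N (Nx≤ N≤i) (Nx≤ ℕ.≤-refl))
      (ℚ.+-mono-≤ (ℚ.<⇒≤ (ℚ.≰⇒> yN≰)) (y-near .proj₂ N i (Ny≤ ℕ.≤-refl) (Ny≤ N≤i))))
    (solve 5 (λ x y xN yN d →
      y :- (x :+ d) := ((xN :+ d) :+ (yN :+ (y :+ d))) :- (x :+ ((xN :+ (d :+ d :+ d)) :+ yN)))
      refl (approx x i) (approx y i) xN yN δ)))

≤ℝ-stable : ∀ {x y} → ¬ ¬ (x ≤ℝ y) → x ≤ℝ y
≤ℝ-stable {x} {y} ¬¬x≤y = ≮ℝ⇒≥ℝ {y} {x} λ y<x → ¬¬x≤y (<ℝ⇒≱ℝ {y} {x} y<x)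

-- Natural numbers among the rationals and reals, and floors

toℚᵘ-/ : ∀ m n .{{_ : NonZero n}} → toℚᵘ (+ m / n) ℚᵘ.≃ + m /ᵘ n
toℚᵘ-/ m (suc d) = ℚ.toℚᵘ-fromℚᵘ (mkℚᵘ (+ m) d)

ι : ℕ → ℚ
ι n = + n / 1

ι-+ : ∀ m n → ι (m + n) ≡ ι m ℚ.+ ι n
ι-+ m n = ℚ.toℚᵘ-injective (begin-equality
  toℚᵘ (ι (m + n))                ≃⟨ toℚᵘ-/ (m + n) 1 ⟩
  + (m + n) /ᵘ 1                  ≃⟨ *≡* (cong (ℤ._* + 1) (cong₂ ℤ._+_
                                       (ℤ.*-identityʳ (+ m)) (ℤ.*-identityʳ (+ n)))) ⟨
  (+ m /ᵘ 1) ℚᵘ.+ (+ n /ᵘ 1)          ≃⟨ ℚᵘ.+-cong (toℚᵘ-/ m 1) (toℚᵘ-/ n 1) ⟨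
  toℚᵘ (ι m) ℚᵘ.+ toℚᵘ (ι n)      ≃⟨ ℚ.toℚᵘ-homo-+ (ι m) (ι n) ⟨
  toℚᵘ (ι m ℚ.+ ι n)              ∎)
  where open ℚᵘ.≤-Reasoning

ι-* : ∀ m n → ι (m * n) ≡ ι m ℚ.* ι n
ι-* m n = ℚ.toℚᵘ-injective (begin-equality
  toℚᵘ (ι (m * n))                ≃⟨ toℚᵘ-/ (m * n) 1 ⟩
  + (m * n) /ᵘ 1                  ≃⟨ *≡* (cong (ℤ._* + 1) (ℤ.pos-* m n)) ⟩
  (+ m /ᵘ 1) ℚᵘ.* (+ n /ᵘ 1)          ≃⟨ ℚᵘ.*-cong (toℚᵘ-/ m 1) (toℚᵘ-/ n 1) ⟨
  toℚᵘ (ι m) ℚᵘ.* toℚᵘ (ι n)      ≃⟨ ℚ.toℚᵘ-homo-* (ι m) (ι n) ⟨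
  toℚᵘ (ι m ℚ.* ι n)              ∎)
  where open ℚᵘ.≤-Reasoning

/-*-cancel : ∀ m n .{{_ : NonZero n}} → (+ m / n) ℚ.* ι n ≡ ι m
/-*-cancel m n@(suc _) = ℚ.toℚᵘ-injective (begin-equality
  toℚᵘ ((+ m / n) ℚ.* ι n)        ≃⟨ ℚ.toℚᵘ-homo-* (+ m / n) (ι n) ⟩
  toℚᵘ (+ m / n) ℚᵘ.* toℚᵘ (ι n)  ≃⟨ ℚᵘ.*-cong (toℚᵘ-/ m n) (toℚᵘ-/ n 1) ⟩
  (+ m /ᵘ n) ℚᵘ.* (+ n /ᵘ 1)          ≃⟨ *≡* (trans (ℤ.*-identityʳ (+ m ℤ.* + n))
                                       (cong (λ d → + m ℤ.* + d) (sym (ℕ.*-identityʳ n)))) ⟩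
  + m /ᵘ 1                        ≃⟨ toℚᵘ-/ m 1 ⟨
  toℚᵘ (ι m)                      ∎)
  where open ℚᵘ.≤-Reasoning

ι-mono : ∀ {m n} → m ≤ n → ι m ℚ.≤ ι n
ι-mono {m} {n} m≤n = ℚ.toℚᵘ-cancel-≤ (begin
  toℚᵘ (ι m)  ≃⟨ toℚᵘ-/ m 1 ⟩
  + m /ᵘ 1    ≤⟨ *≤* (ℤ.*-monoʳ-≤-nonNeg (+ 1) (ℤ.+≤+ m≤n)) ⟩
  + n /ᵘ 1    ≃⟨ toℚᵘ-/ n 1 ⟨
  toℚᵘ (ι n)  ∎)
  where open ℚᵘ.≤-Reasoning

ι-pos : ∀ n .{{_ : NonZero n}} → 0ℚ ℚ.< ι n
ι-pos (suc n) = ℚ.<-≤-trans (ℚ.positive⁻¹ 1ℚ) (ι-mono {1} {suc n} (s≤s z≤n))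

-- Distinct naturals differ by at least 1, so the inequality with error `½` already decides.
fromℕ-cancel-≤ : ∀ {m n} → fromℕ m ≤ℝ fromℕ n → m ≤ n
fromℕ-cancel-≤ {m} {n} m≤n = ℕ.≮⇒≥ λ n<m → ℚ.<-irrefl refl (ℚ.<-≤-trans (ℚ.positive⁻¹ ½)
  (≤-from-difference ((ι 1 ℚ.+ ι n) ℚ.+ ι m) (ι m ℚ.+ (ι n ℚ.+ ½))
    (ℚ.+-mono-≤ (subst (ℚ._≤ ι m) (ι-+ 1 n) (ι-mono n<m))
                (m≤n ½ (ℚ.positive⁻¹ ½) .proj₂ _ ℕ.≤-refl))
    (solve 2 (λ m n → con 0ℚ :- con ½ := (m :+ (n :+ con ½)) :- ((con (ι 1) :+ n) :+ m))
      refl (ι m) (ι n))))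
  where open +-*-Solver

·-mono : ∀ c .{{_ : NonZero c}} {x y} → x ≤ℝ y → (ι c · x) ≤ℝ (ι c · y)
·-mono c {x} {y} x≤y ε 0<ε = x≤y′ .proj₁ , λ n N≤n → begin
  ι c ℚ.* approx x n                ≤⟨ ℚ.*-monoˡ-≤-nonNeg (ι c) {{ℚ.nonNegative (ℚ.<⇒≤ (ι-pos c))}}
                                         (x≤y′ .proj₂ n N≤n) ⟩
  ι c ℚ.* (approx y n ℚ.+ δ)        ≡⟨ solve 4 (λ c y i e → c :* (y :+ i :* e) := c :* y :+ (i :* c) :* e)
                                         refl (ι c) (approx y n) (+ 1 / c) ε ⟩
  ι c ℚ.* approx y n ℚ.+ ((+ 1 / c) ℚ.* ι c) ℚ.* ε
                                    ≡⟨ cong (λ z → ι c ℚ.* approx y n ℚ.+ z)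
                                         (trans (cong (ℚ._* ε) (/-*-cancel 1 c)) (ℚ.*-identityˡ ε)) ⟩
  ι c ℚ.* approx y n ℚ.+ ε          ∎
  where
  open ℚ.≤-Reasoning
  open +-*-Solver
  δ = (+ 1 / c) ℚ.* ε
  1/c-pos : 0ℚ ℚ.< (+ 1 / c)
  1/c-pos = ℚ.*-cancelʳ-<-nonNeg (ι c) {{ℚ.nonNegative (ℚ.<⇒≤ (ι-pos c))}}
    (subst₂ ℚ._<_ (sym (ℚ.*-zeroˡ (ι c))) (sym (/-*-cancel 1 c)) (ℚ.positive⁻¹ 1ℚ))
  x≤y′ = x≤y δ (*-pos {+ 1 / c} {ε} 1/c-pos 0<ε)

≤ℝ-reflexive : ∀ {x y} → (∀ n → approx x n ≡ approx y n) → x ≤ℝ y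
≤ℝ-reflexive {x} {y} x≗y ε 0<ε = 0 , λ n _ →
  ℚ.≤-trans (ℚ.≤-reflexive (trans (x≗y n) (sym (ℚ.+-identityʳ (approx y n)))))
            (ℚ.+-monoʳ-≤ (approx y n) (ℚ.<⇒≤ 0<ε))

-- The floor is the greatest `j` with `fromℕ j ≤ℝ x`. If `x` were not below `suc k`, then `suc k`
-- would be such a `j` too; this yields `x <ℝ fromℕ (suc k)` up to a double negation, which the goal
-- absorbs.
¬¬-floor : ∀ {x} b → fromℕ 0 ≤ℝ x → x ≤ℝ fromℕ b → ¬ ¬ ∃ (IsFloor x)
¬¬-floor {x} b 0≤x x≤b ¬floor =
  ¬¬-max {λ j → fromℕ j ≤ℝ x} {0} b
    (λ j j≤x → fromℕ-cancel-≤ (≤ℝ-trans {fromℕ j} {x} {fromℕ b} j≤x x≤b)) 0≤x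
  λ (k , k≤x , greatest) → ¬¬x<1+k k greatest λ x<1+k → ¬floor (k , k≤x , x<1+k)
  where
  ¬¬x<1+k : ∀ k → (∀ j → fromℕ j ≤ℝ x → j ≤ k) → ¬ ¬ (x <ℝ fromℕ (suc k))
  ¬¬x<1+k k greatest x≮1+k =
    ℕ.1+n≰n (greatest (suc k) (≮ℝ⇒≥ℝ {x} {fromℕ (suc k)} x≮1+k))

-- From edge counts to the edit distance function

-- The integer bound is divided by `s * c`. The error `δ` in `k` is tripled and then divided by
-- `s * c`, which is at least 3, so it does not grow.
dist/-≤ : ∀ s c m k .{{_ : NonZero s}} .{{_ : NonZero c}} → 3 ≤ s → s * m ≤ 3 * k + c →
  ∀ p δ → 0ℚ ℚ.≤ δ → ι k ℚ.≤ ι c ℚ.* p ℚ.+ δ →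
  (+ m / c) ℚ.≤ (+ 1 / s) ℚ.* (ι 3 ℚ.* p ℚ.+ ι 1) ℚ.+ δ
dist/-≤ s c m k 3≤s sm≤ p δ 0≤δ k≤ = ℚ.*-cancelʳ-≤-pos (ι s ℚ.* ι c) {{ℚ.positive 0<sc}} (begin
  (+ m / c) ℚ.* (ι s ℚ.* ι c)
    ≡⟨ solve 3 (λ q s c → q :* (s :* c) := s :* (q :* c)) refl (+ m / c) (ι s) (ι c) ⟩
  ι s ℚ.* ((+ m / c) ℚ.* ι c)
    ≡⟨ cong (ι s ℚ.*_) (/-*-cancel m c) ⟩
  ι s ℚ.* ι m
    ≡⟨ ι-* s m ⟨
  ι (s * m)
    ≤⟨ ι-mono sm≤ ⟩
  ι (3 * k + c)
    ≡⟨ trans (ι-+ (3 * k) c) (cong (ℚ._+ ι c) (ι-* 3 k)) ⟩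
  ι 3 ℚ.* ι k ℚ.+ ι c
    ≤⟨ ℚ.+-monoˡ-≤ (ι c) (ℚ.*-monoˡ-≤-nonNeg (ι 3) k≤) ⟩
  ι 3 ℚ.* (ι c ℚ.* p ℚ.+ δ) ℚ.+ ι c
    ≡⟨ solve 3 (λ c p d → con (ι 3) :* (c :* p :+ d) :+ c :=
         (con (ι 3) :* p :+ con (ι 1)) :* c :+ con (ι 3) :* d)
         refl (ι c) p δ ⟩
  X ℚ.* ι c ℚ.+ ι 3 ℚ.* δ
    ≤⟨ ℚ.+-monoʳ-≤ (X ℚ.* ι c) (ℚ.*-monoʳ-≤-nonNeg δ {{ℚ.nonNegative 0≤δ}} (ι-mono 3≤sc)) ⟩
  X ℚ.* ι c ℚ.+ ι (s * c) ℚ.* δ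
    ≡⟨ cong₂ (λ x y → x ℚ.+ y ℚ.* δ)
         (trans (cong (ℚ._* (X ℚ.* ι c)) (/-*-cancel 1 s)) (ℚ.*-identityˡ (X ℚ.* ι c)))
         (sym (ι-* s c)) ⟨
  ((+ 1 / s) ℚ.* ι s) ℚ.* (X ℚ.* ι c) ℚ.+ (ι s ℚ.* ι c) ℚ.* δ
    ≡⟨ solve 5 (λ i s x c d → (i :* s) :* (x :* c) :+ (s :* c) :* d :=
         (i :* x :+ d) :* (s :* c)) refl (+ 1 / s) (ι s) X (ι c) δ ⟩
  ((+ 1 / s) ℚ.* X ℚ.+ δ) ℚ.* (ι s ℚ.* ι c) ∎)
  where
  open ℚ.≤-Reasoning
  open +-*-Solver
  X = ι 3 ℚ.* p ℚ.+ ι 1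
  0<sc : 0ℚ ℚ.< ι s ℚ.* ι c
  0<sc = *-pos (ι-pos s) (ι-pos c)
  3≤sc : 3 ≤ s * c
  3≤sc = ℕ.≤-trans 3≤s (ℕ.m≤m*n s c)

module _ (t : ℕ) (2≤t : 2 ≤ t) {n : ℕ} where

  maxDist-≤ : ∀ {k m} → IsMaxDist (Forb (K 2 t)) n k m → (5 + t) * m ≤ 3 * k + n C 2
  maxDist-≤ {k} {m} ((G , G-edges , _ , least) , _) with recolouring t 2≤t G
  ... | G′ , G′-free , G′-near = begin
    (5 + t) * m               ≤⟨ ℕ.*-monoʳ-≤ (5 + t) (least (dist G G′) (G′ , G′-free , refl)) ⟩
    (5 + t) * dist G G′       ≤⟨ G′-near ⟩
    3 * edgeCount G + n C 2   ≡⟨ cong (λ e → 3 * e + n C 2) G-edges ⟩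
    3 * k + n C 2             ∎
    where open ℕ.≤-Reasoning

  -- Some graph has `k` edges, `recolouring` shows that its distance is a minimum over a nonempty
  -- set, and no distance exceeds `n C 2`.
  ¬¬-maxDist : ∀ {k} → k ≤ n C 2 → ¬ ¬ ∃ (IsMaxDist (Forb (K 2 t)) n k)
  ¬¬-maxDist {k} k≤ ¬max with graph-with-edges n k k≤
  ... | G , G-edges with recolouring t 2≤t G
  ... | G′ , G′-free , _ = ¬¬-min (G′ , G′-free , refl) λ (d , d-dist) →
    ¬¬-max (n C 2) bounded (G , G-edges , d-dist) ¬max
    where
    bounded : ∀ j → (∃ λ (G : Graph n) → edgeCount G ≡ k × IsDistTo (Forb (K 2 t)) G j) → j ≤ n C 2
    bounded j (G , _ , (G′ , _ , j≡) , _) = subst (_≤ n C 2) (sym j≡) (edgeCount≤nC2 (G △ G′))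

theorem11 : (t : ℕ) → 2 ≤ t →
    (p : ℝ) → fromℕ 0 ≤ℝ p → p ≤ℝ fromℕ 1 →
    (e : ℝ) → IsEd (Forb (K 2 t)) p e →
    e ≤ℝ ((+ 3 / 1) · p +ℝ fromℕ 1) ÷ (5 + t)
theorem11 t 2≤t p 0≤p p≤1 e e-ed = e≤y
  where
  open +-*-Solver
  y = ((+ 3 / 1) · p +ℝ fromℕ 1) ÷ (5 + t)

  e≤y+_ : ∀ ε → 0ℚ ℚ.< ε → e ≤ℝ y +ℝ fromℚ ε
  -- The goal is stable, so the floor `k` and the maximum `m` may be taken out of their double
  -- negations.
  (e≤y+ ε) 0<ε = ≤ℝ-stable {e} {y +ℝ fromℚ ε} λ e≰ →
    ¬¬-floor {x} c 0≤x x≤c λ (k , k-floor) →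
    ¬¬-maxDist t 2≤t {n} (fromℕ-cancel-≤ (≤ℝ-trans {fromℕ k} {x} {fromℕ c} (k-floor .proj₁) x≤c))
    λ (m , m-max) → e≰ (≤y k k-floor m m-max)
    where
    N = e-ed ε 0<ε .proj₁
    -- One order beyond `N` suffices, since the bound on `m` holds at every order; the 2 makes
    -- `n C 2` nonzero.
    n = 2 + N
    c = n C 2
    instance
      c-nonZero : NonZero c
      c-nonZero = subst NonZero (sym ([1+n]C2≡n+nC2 (suc N))) _
    x = ι c · p
    0≤x : fromℕ 0 ≤ℝ x
    0≤x = ≤ℝ-trans {fromℕ 0} {ι c · fromℕ 0} {x}
      (≤ℝ-reflexive {fromℕ 0} {ι c · fromℕ 0} λ _ → sym (ℚ.*-zeroʳ (ι c))) (·-mono c {fromℕ 0} {p} 0≤p)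
    x≤c : x ≤ℝ fromℕ c
    x≤c = ≤ℝ-trans {x} {ι c · fromℕ 1} {fromℕ c} (·-mono c {p} {fromℕ 1} p≤1)
      (≤ℝ-reflexive {ι c · fromℕ 1} {fromℕ c} λ _ → ℚ.*-identityʳ (ι c))

    ≤y : ∀ k → IsFloor x k → ∀ m → IsMaxDist (Forb (K 2 t)) n k m → e ≤ℝ y +ℝ fromℚ ε
    ≤y k k-floor m m-max δ 0<δ = e≤ .proj₁ ⊔ k≤ .proj₁ , λ i N≤i →
      ≤-from-difference
        (approx e i ℚ.+ (+ m / c))
        (((+ m / c) ℚ.+ ε ℚ.+ ½ ℚ.* δ) ℚ.+ (approx y i ℚ.+ ½ ℚ.* δ))
        (ℚ.+-mono-≤ (e≤ .proj₂ i (ℕ.m⊔n≤o⇒m≤o _ _ N≤i))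
          (dist/-≤ (5 + t) c m k (s≤s (s≤s (s≤s z≤n))) (maxDist-≤ t 2≤t m-max)
            (approx p i) (½ ℚ.* δ) (ℚ.<⇒≤ 0<½δ) (k≤ .proj₂ i (ℕ.m⊔n≤o⇒n≤o _ _ N≤i))))
        (solve 5 (λ e q ε d y → (y :+ ε :+ d) :- e :=
           ((q :+ ε :+ con ½ :* d) :+ (y :+ con ½ :* d)) :- (e :+ q))
           refl (approx e i) (+ m / c) ε δ (approx y i))
      where
      0<½δ = *-pos {½} {δ} (ℚ.positive⁻¹ ½) 0<δ
      within = e-ed ε 0<ε .proj₂ n (ℕ.m≤n+m N 2) k m k-floor m-max
      e≤ = within .proj₂ (½ ℚ.* δ) 0<½δ
      k≤ = k-floor .proj₁ (½ ℚ.* δ) 0<½δ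

  e≤y : e ≤ℝ y
  -- Half of `ε` pays for the tolerance in the limit, half for the slack in `_≤ℝ_`.
  e≤y ε 0<ε = e≤ .proj₁ , λ n N≤n → ℚ.≤-trans (e≤ .proj₂ n N≤n) (ℚ.≤-reflexive
    (solve 2 (λ y e → y :+ con ½ :* e :+ con ½ :* e := y :+ e) refl (approx y n) ε))
    where
    0<½ε = *-pos {½} {ε} (ℚ.positive⁻¹ ½) 0<ε
    e≤ = (e≤y+ (½ ℚ.* ε)) 0<½ε (½ ℚ.* ε) 0<½ε
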